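{- Let $G$ be a sub-amply regular graph with parameters $(n,k,\lambda,\mu)$ which is not a disjoint union of cliques. Then \[ \lambda + 1 < \max\left\{4\sqrt{2n},\ \frac{6}{\sqrt{13}-1}\sqrt{k(\mu-1)}\right\}. \]
   Context: A graph is sub-amply regular with parameters $(n,k,\lambda,\mu)$ if it is $k$-regular on $n$ vertices, any two adjacent vertices have exactly $\lambda$ common neighbors, and any two vertices at distance two from each other have at most $\mu$ common neighbors. -}

module Defs where

open import Data.Nat using (ℕ; _+_; _*_; _∸_; _<_; _≤_)
open import Data.Fin using (Fin)
open import Data.Bool using (Bool; true; false; _∧_; T)
open import Data.List using (List; length; allFin; filterᵇ)
open import Data.Product using (Σ; _×_; ∃)
open import Data.Sum using (_⊎_)
open import Relation.Binary.PropositionalEquality using (_≡_; _≢_)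
open import Relation.Nullary using (¬_)

record Graph (n : ℕ) : Set where
  field
    adj   : Fin n → Fin n → Bool
    sym   : ∀ u v → adj u v ≡ adj v u
    irrefl : ∀ v → adj v v ≡ false

open Graph public

Adj : ∀ {n} → Graph n → Fin n → Fin n → Set
Adj G u v = T (adj G u v)

degree : ∀ {n} → Graph n → Fin n → ℕ
degree {n} G v = length (filterᵇ (adj G v) (allFin n))

common : ∀ {n} → Graph n → Fin n → Fin n → ℕ
common {n} G u v = length (filterᵇ (λ w → adj G u w ∧ adj G v w) (allFin n))

Dist2 : ∀ {n} → Graph n → Fin n → Fin n → Set
Dist2 G u v = u ≢ v × ¬ Adj G u v × ∃ λ w → Adj G u w × Adj G w v

SubAmplyRegular : ∀ {n} → Graph n → ℕ → ℕ → ℕ → Set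
SubAmplyRegular {n} G k l m =
  (∀ v → degree G v ≡ k) ×
  (∀ u v → Adj G u v → common G u v ≡ l) ×
  (∀ u v → Dist2 G u v → common G u v ≤ m)

DisjointUnionOfCliques : ∀ {n} → Graph n → Set
DisjointUnionOfCliques G =
  ∀ u v w → Adj G u v → Adj G v w → u ≢ w → Adj G u w

_<√_ : ℕ → ℕ → Set
a <√ m = a * a < m

-- LtC a B encodes the real inequality  a < (6/(√13-1)) · √B.
-- Since (6/(√13-1))² = (7+√13)/2, this is  2a² < 7B + √13·B, i.e. with
-- A = 2a²:  A ≤ 7B and 0 < B,  or  7B < A and (A-7B)² < 13B².
LtC : ℕ → ℕ → Set
LtC a B = let A = 2 * (a * a) in
  (A ≤ 7 * B × 0 < B) ⊎ (7 * B < A × (A ∸ 7 * B) * (A ∸ 7 * B) < 13 * (B * B))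

{-# OPTIONS --safe #-}
-- Fix a vertex v and put s = l + 1.  In the graph induced on Γ(v) the closed
-- neighbourhoods have size s, and two of them centred at non-adjacent vertices
-- meet in at most m - 1 points.  If LtC fails, then 5k(m - 1) ≤ s² (as 3 < √13), and
-- every independent set S of Γ(v) satisfies 3|S|(m - 1) ≤ s.  If S cannot be enlarged by replacing x ∈ S
-- with two vertices, then the neighbours of x that are private to x form a clique,
-- of size at least 2s/3.  So every vertex lies on two "lines", i.e. cliques with at
-- least 2s/3 + 1 points, that are not contained in a common clique, whereas
-- two lines sharing an edge span a clique.  Lines through s/3 + 1 distinct points
-- of one line C, none of them spanning a clique with C, pairwise share at
-- most one point; counting their union gives s² < 9n ≤ 32n.
module Submission where

open import Defs
open import Data.Nat using (ℕ; zero; suc; _+_; _*_; _∸_; _/_; _%_; _≤_; _<_; z≤n; s≤s; z<s; _<?_; NonZero)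
open import Data.Nat.Properties hiding (_≟_)
open import Data.Nat.DivMod using (m≡m%n+[m/n]*n; m%n<n; m/n*n≤m)
open import Data.Nat.Tactic.RingSolver using (solve-∀)
open import Data.Fin using (Fin; zero; suc; _≟_)
open import Data.Fin.Properties using (any?)
open import Data.Fin.Subset
open import Data.Fin.Subset.Properties
open import Data.Bool using (Bool; true; false; T; _∧_; T?)
open import Data.Bool.Properties using (T-≡)
open import Data.Vec using (_∷_; []; tabulate; lookup)
open import Data.Vec.Properties using (lookup∘tabulate; tabulate∘lookup; tabulate-cong; lookup-zipWith; lookup⇒[]=; []=⇒lookup)
open import Data.List using (List; []; _∷_; length; map; filterᵇ; allFin; take)
import Data.List as List
open import Data.List.Properties using (length-take)
open import Data.List.Relation.Unary.All as All using (All; []; _∷_)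
import Data.List.Relation.Unary.All.Properties as All
open import Data.List.Relation.Unary.AllPairs using (AllPairs; []; _∷_)
open import Data.List.Relation.Unary.Unique.Propositional using (Unique)
import Data.List.Relation.Unary.Unique.Propositional.Properties as Unique
open import Data.Product using (∃; ∃₂; _×_; _,_; proj₁; proj₂)
open import Data.Sum using (_⊎_; inj₁; inj₂; [_,_]′)
open import Data.Empty using (⊥-elim)
open import Function using (_∘_; id)
open import Function.Bundles using (Equivalence)
open import Relation.Nullary using (¬_; yes; no; contradiction)
open import Relation.Nullary.Decidable using (_×-dec_; ¬?; decidable-stable)
open import Relation.Binary.PropositionalEquality using (_≡_; _≢_; refl; cong; cong₂; subst; trans; ≢-sym)
import Relation.Binary.PropositionalEquality as ≡

-- Arithmetic consequences of the failure of `LtC`.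

-- If the difference D = 2a² - 7B has D² ≥ 13B², then D ≥ 3B because 9 ≤ 13, so 2a² = 7B + D ≥ 10B.
-- The integer 5 thus replaces the constant (7 + √13)/2.
LtC-or-≥ : ∀ a B → LtC a B ⊎ 5 * B ≤ a * a
LtC-or-≥ a B with 7 * B <? 2 * (a * a)
-- The first case of `LtC` demands 0 < B, so B = 0 goes to the other side, where the bound is
-- trivial.
LtC-or-≥ a zero    | no ≮ = inj₂ z≤n
LtC-or-≥ a (suc B) | no ≮ = inj₁ (inj₁ (≮⇒≥ ≮ , z<s))
LtC-or-≥ a B | yes 7B<A with (2 * (a * a) ∸ 7 * B) * (2 * (a * a) ∸ 7 * B) <? 13 * (B * B)
... | yes D²<13B² = inj₁ (inj₂ (7B<A , D²<13B²))
... | no  D²≮13B² = inj₂ (*-cancelˡ-≤ 2 (begin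
    2 * (5 * B)    ≡⟨ identity₁ B ⟩
    7 * B + 3 * B  ≤⟨ +-monoʳ-≤ (7 * B) 3B≤D ⟩
    7 * B + D      ≡⟨ m+[n∸m]≡n (<⇒≤ 7B<A) ⟩
    2 * (a * a)    ∎))
  where
  open ≤-Reasoning
  D : ℕ
  D = 2 * (a * a) ∸ 7 * B
  identity₁ : ∀ B → 2 * (5 * B) ≡ 7 * B + 3 * B
  identity₁ = solve-∀
  identity₂ : ∀ B → 3 * B * (3 * B) ≡ 9 * (B * B)
  identity₂ = solve-∀
  3B≤D : 3 * B ≤ D
  3B≤D = ≮⇒≥ λ D<3B → D²≮13B² (begin-strict
    D * D              <⟨ *-mono-< D<3B D<3B ⟩
    3 * B * (3 * B)    ≡⟨ identity₂ B ⟩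
    9 * (B * B)        ≤⟨ *-monoˡ-≤ (B * B) (m≤m+n 9 4) ⟩
    13 * (B * B)       ∎)

-- Multiplying the bound on r by 5μ gives 10rμs ≤ 15kμ ≤ 3s². Weakening 10 to 9 lets the factor 3s
-- cancel.
packing-bound : ∀ r s k μ .{{_ : NonZero s}} → r * (2 * s) ≤ 3 * k → 5 * (k * μ) ≤ s * s → 3 * (r * μ) ≤ s
packing-bound r s k μ 2rs≤3k 5kμ≤s² = *-cancelˡ-≤ 3 (*-cancelʳ-≤ _ _ s (begin
  3 * (3 * (r * μ)) * s  ≡⟨ identity₁ r μ s ⟩
  9 * (r * μ * s)        ≤⟨ *-monoˡ-≤ (r * μ * s) (n≤1+n 9) ⟩
  10 * (r * μ * s)       ≡⟨ identity₂ r μ s ⟩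
  5 * μ * (r * (2 * s))  ≤⟨ *-monoʳ-≤ (5 * μ) 2rs≤3k ⟩
  5 * μ * (3 * k)        ≡⟨ identity₃ μ k ⟩
  3 * (5 * (k * μ))      ≤⟨ *-monoʳ-≤ 3 5kμ≤s² ⟩
  3 * (s * s)            ≡⟨ *-assoc 3 s s ⟨
  3 * s * s              ∎))
  where
  open ≤-Reasoning
  identity₁ : ∀ r μ s → 3 * (3 * (r * μ)) * s ≡ 9 * (r * μ * s)
  identity₁ = solve-∀
  identity₂ : ∀ r μ s → 10 * (r * μ * s) ≡ 5 * μ * (r * (2 * s))
  identity₂ = solve-∀
  identity₃ : ∀ μ k → 5 * μ * (3 * k) ≡ 3 * (5 * (k * μ))
  identity₃ = solve-∀

-- From s ≤ k follows 5s(m - 1) ≤ s², so 5(m - 1) ≤ s. For m ≤ 1 the factor `m ∸ 1` vanishes, and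
-- strictness comes from 3 > 0 or s > 0 instead of 3 < 5.
3m<s+3 : ∀ m s k .{{_ : NonZero s}} → s ≤ k → 5 * (k * (m ∸ 1)) ≤ s * s → 3 * m < s + 3
3m<s+3 zero          s k s≤k _ = ≤-trans z<s (m≤n+m 3 s)
3m<s+3 (suc zero)    (suc s) k s≤k _ = s≤s (m≤n+m 3 s)
3m<s+3 (suc m@(suc _)) s k s≤k 5kμ≤s² = begin-strict
  3 * suc m    ≡⟨ *-suc 3 m ⟩
  3 + 3 * m    <⟨ +-monoʳ-< 3 (*-monoˡ-< m {x = 3} {y = 5} (s≤s (s≤s (s≤s (s≤s z≤n))))) ⟩
  3 + 5 * m    ≤⟨ +-monoʳ-≤ 3 5m≤s ⟩
  3 + s        ≡⟨ +-comm 3 s ⟩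
  s + 3        ∎
  where
  open ≤-Reasoning
  identity : ∀ s m → 5 * m * s ≡ 5 * (s * m)
  identity = solve-∀
  5m≤s : 5 * m ≤ s
  5m≤s = *-cancelʳ-≤ _ _ s (begin
    5 * m * s    ≡⟨ identity s m ⟩
    5 * (s * m)  ≤⟨ *-monoʳ-≤ 5 (*-monoˡ-≤ m s≤k) ⟩
    5 * (k * m)  ≤⟨ 5kμ≤s² ⟩
    s * s        ∎)

-- Cardinalities of subsets

∣p∪q∣+∣p∩q∣≡∣p∣+∣q∣ : ∀ {n} (p q : Subset n) → ∣ p ∪ q ∣ + ∣ p ∩ q ∣ ≡ ∣ p ∣ + ∣ q ∣
∣p∪q∣+∣p∩q∣≡∣p∣+∣q∣ []          []          = refl
∣p∪q∣+∣p∩q∣≡∣p∣+∣q∣ (true  ∷ p) (true  ∷ q) = cong suc (begin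
  ∣ p ∪ q ∣ + suc ∣ p ∩ q ∣  ≡⟨ +-suc ∣ p ∪ q ∣ ∣ p ∩ q ∣ ⟩
  suc (∣ p ∪ q ∣ + ∣ p ∩ q ∣) ≡⟨ cong suc (∣p∪q∣+∣p∩q∣≡∣p∣+∣q∣ p q) ⟩
  suc (∣ p ∣ + ∣ q ∣)         ≡⟨ +-suc ∣ p ∣ ∣ q ∣ ⟨
  ∣ p ∣ + suc ∣ q ∣           ∎)
  where open ≡.≡-Reasoning
∣p∪q∣+∣p∩q∣≡∣p∣+∣q∣ (true  ∷ p) (false ∷ q) = cong suc (∣p∪q∣+∣p∩q∣≡∣p∣+∣q∣ p q)
∣p∪q∣+∣p∩q∣≡∣p∣+∣q∣ (false ∷ p) (true  ∷ q) =
  trans (cong suc (∣p∪q∣+∣p∩q∣≡∣p∣+∣q∣ p q)) (≡.sym (+-suc ∣ p ∣ ∣ q ∣))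
∣p∪q∣+∣p∩q∣≡∣p∣+∣q∣ (false ∷ p) (false ∷ q) = ∣p∪q∣+∣p∩q∣≡∣p∣+∣q∣ p q

-- Links the size of a subset to the list counts that define `degree` and `common`. The general g
-- serves the induction, whose tail is tabulated along `g ∘ suc`.
∣tabulate∣ : ∀ {n} {A : Set} (f : A → Bool) (g : Fin n → A) →
             ∣ tabulate (f ∘ g) ∣ ≡ length (filterᵇ f (List.tabulate g))
∣tabulate∣ {zero}  f g = refl
∣tabulate∣ {suc n} f g with f (g zero)
... | true  = cong suc (∣tabulate∣ f (g ∘ suc))
... | false = ∣tabulate∣ f (g ∘ suc)

module _ {n : ℕ} where

  ∣p∪q∣≤∣p∣+∣q∣ : (p q : Subset n) → ∣ p ∪ q ∣ ≤ ∣ p ∣ + ∣ q ∣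
  ∣p∪q∣≤∣p∣+∣q∣ p q = ≤-trans (m≤m+n _ _) (≤-reflexive (∣p∪q∣+∣p∩q∣≡∣p∣+∣q∣ p q))

  ∣p∣≤∣p∩q∣+∣p∩∁q∣ : (p q : Subset n) → ∣ p ∣ ≤ ∣ p ∩ q ∣ + ∣ p ∩ ∁ q ∣
  ∣p∣≤∣p∩q∣+∣p∩∁q∣ p q = ≤-trans (p⊆q⇒∣p∣≤∣q∣ p⊆) (∣p∪q∣≤∣p∣+∣q∣ (p ∩ q) (p ∩ ∁ q))
    where
    p⊆ : p ⊆ (p ∩ q) ∪ (p ∩ ∁ q)
    p⊆ {x} x∈p with x ∈? q
    ... | yes x∈q = x∈p∪q⁺ (inj₁ (x∈p∩q⁺ (x∈p , x∈q)))
    ... | no  x∉q = x∈p∪q⁺ (inj₂ (x∈p∩q⁺ (x∈p , x∉p⇒x∈∁p x∉q)))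

  ∣⁅x⁆∪p∣≡1+∣p∣ : ∀ {x} (p : Subset n) → x ∉ p → ∣ ⁅ x ⁆ ∪ p ∣ ≡ suc ∣ p ∣
  ∣⁅x⁆∪p∣≡1+∣p∣ {x} p x∉p = begin
    ∣ ⁅ x ⁆ ∪ p ∣                  ≡⟨ +-identityʳ _ ⟨
    ∣ ⁅ x ⁆ ∪ p ∣ + 0              ≡⟨ cong (∣ ⁅ x ⁆ ∪ p ∣ +_) ∣⁅x⁆∩p∣≡0 ⟨
    ∣ ⁅ x ⁆ ∪ p ∣ + ∣ ⁅ x ⁆ ∩ p ∣  ≡⟨ ∣p∪q∣+∣p∩q∣≡∣p∣+∣q∣ ⁅ x ⁆ p ⟩
    ∣ ⁅ x ⁆ ∣ + ∣ p ∣              ≡⟨ cong (_+ ∣ p ∣) (∣⁅x⁆∣≡1 x) ⟩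
    suc ∣ p ∣                      ∎
    where
    open ≡.≡-Reasoning
    empty : Empty (⁅ x ⁆ ∩ p)
    empty (y , y∈) with x∈p∩q⁻ ⁅ x ⁆ p y∈
    ... | y∈⁅x⁆ , y∈p = x∉p (subst (_∈ p) (x∈⁅y⁆⇒x≡y x y∈⁅x⁆) y∈p)
    ∣⁅x⁆∩p∣≡0 : ∣ ⁅ x ⁆ ∩ p ∣ ≡ 0
    ∣⁅x⁆∩p∣≡0 = trans (cong ∣_∣ (Empty-unique empty)) (∣⊥∣≡0 n)

  ∣q∣<∣p∣⇒p⊈q : (p q : Subset n) → ∣ q ∣ < ∣ p ∣ → ∃ λ x → x ∈ p × x ∉ q
  ∣q∣<∣p∣⇒p⊈q p q ∣q∣<∣p∣ with any? (λ x → (x ∈? p) ×-dec ¬? (x ∈? q))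
  ... | yes found = found
  ... | no  none  = contradiction
    (p⊆q⇒∣p∣≤∣q∣ {p = p} {q = q} λ {x} x∈p → decidable-stable (x ∈? q) λ x∉q → none (x , x∈p , x∉q))
    (<⇒≱ ∣q∣<∣p∣)

  ∣p∣>1⇒two-elements : (p : Subset n) → 1 < ∣ p ∣ → ∃₂ λ x y → x ∈ p × y ∈ p × x ≢ y
  ∣p∣>1⇒two-elements p 1<∣p∣
    with x , x∈p , _ ← ∣q∣<∣p∣⇒p⊈q p ⊥ (subst (_< ∣ p ∣) (≡.sym (∣⊥∣≡0 n)) (<-trans z<s 1<∣p∣))
    with y , y∈p , y∉⁅x⁆ ← ∣q∣<∣p∣⇒p⊈q p ⁅ x ⁆ (subst (_< ∣ p ∣) (≡.sym (∣⁅x⁆∣≡1 x)) 1<∣p∣)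
    = x , y , x∈p , y∈p , ≢-sym (x∉⁅y⁆⇒x≢y y∉⁅x⁆)

  ∈-tabulate⁺ : (f : Fin n → Bool) {x : Fin n} → T (f x) → x ∈ tabulate f
  ∈-tabulate⁺ f {x} fx = lookup⇒[]= x _ (trans (lookup∘tabulate f x) (Equivalence.to T-≡ fx))

  ∈-tabulate⁻ : (f : Fin n → Bool) {x : Fin n} → x ∈ tabulate f → T (f x)
  ∈-tabulate⁻ f {x} x∈ = Equivalence.from T-≡ (trans (≡.sym (lookup∘tabulate f x)) ([]=⇒lookup x∈))

  tabulate-∧ : (f g : Fin n → Bool) → tabulate (λ x → f x ∧ g x) ≡ tabulate f ∩ tabulate g
  tabulate-∧ f g = trans (tabulate-cong λ x → ≡.sym (trans (lookup-zipWith _∧_ x (tabulate f) (tabulate g))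
    (cong₂ _∧_ (lookup∘tabulate f x) (lookup∘tabulate g x)))) (tabulate∘lookup _)

  distinct-elements : (p : Subset n) (r : ℕ) → r ≤ ∣ p ∣ →
                      ∃ λ xs → length xs ≡ r × All (_∈ p) xs × Unique xs
  distinct-elements p r r≤∣p∣ =
    take r elements
    , trans (length-take r elements) (m≤n⇒m⊓n≡m (≤-trans r≤∣p∣ (≤-reflexive ∣p∣≡length)))
    , All.take⁺ r (All.map (λ {x} → lookup⇒[]= x p ∘ Equivalence.to T-≡)
                           (All.all-filter (T? ∘ lookup p) (allFin n)))
    , Unique.take⁺ r (Unique.filter⁺ (T? ∘ lookup p) (Unique.allFin⁺ n))
    where
    elements : List (Fin n)
    elements = filterᵇ (lookup p) (allFin n)
    ∣p∣≡length : ∣ p ∣ ≡ length elements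
    ∣p∣≡length = trans (cong ∣_∣ (≡.sym (tabulate∘lookup p))) (∣tabulate∣ (lookup p) id)

  ⋃-⊆ : {A : Set} (F : A → Subset n) {q : Subset n} {xs : List A} →
        All (λ x → F x ⊆ q) xs → ⋃ (map F xs) ⊆ q
  ⋃-⊆ F []         y∈ = contradiction y∈ ∉⊥
  ⋃-⊆ F (Fx⊆q ∷ h) y∈ = [ Fx⊆q , ⋃-⊆ F h ]′ (x∈p∪q⁻ (F _) _ y∈)

  ∣p∩⋃∣≤ : {A : Set} (F : A → Subset n) (p : Subset n) {m : ℕ} {xs : List A} →
           All (λ x → ∣ p ∩ F x ∣ ≤ m) xs → ∣ p ∩ ⋃ (map F xs) ∣ ≤ length xs * m
  ∣p∩⋃∣≤ F p [] = ≤-reflexive (trans (cong ∣_∣ (∩-zeroʳ p)) (∣⊥∣≡0 n))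
  ∣p∩⋃∣≤ F p {m} {x ∷ xs} (h ∷ hs) = begin
    ∣ p ∩ (F x ∪ ⋃ (map F xs)) ∣              ≡⟨ cong ∣_∣ (∩-distribˡ-∪ p (F x) _) ⟩
    ∣ (p ∩ F x) ∪ (p ∩ ⋃ (map F xs)) ∣        ≤⟨ ∣p∪q∣≤∣p∣+∣q∣ (p ∩ F x) _ ⟩
    ∣ p ∩ F x ∣ + ∣ p ∩ ⋃ (map F xs) ∣        ≤⟨ +-mono-≤ h (∣p∩⋃∣≤ F p hs) ⟩
    m + length xs * m                         ∎
    where open ≤-Reasoning

  -- A set meets the union of the at most R later ones in at most R m points, so it adds at least b
  -- / c new points. The factor c keeps the estimate free of fractions.
  ∣⋃∣≥ : {A : Set} (F : A → Subset n) (m b c R : ℕ) (xs : List A) →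
         All (λ x → b + c * (R * m) ≤ c * ∣ F x ∣) xs →
         AllPairs (λ x y → ∣ F x ∩ F y ∣ ≤ m) xs →
         length xs ≤ suc R → length xs * b ≤ c * ∣ ⋃ (map F xs) ∣
  ∣⋃∣≥ F m b c R []       _          _          _         = z≤n
  ∣⋃∣≥ F m b c R (x ∷ xs) (big ∷ hs) (meet ∷ ms) (s≤s len) = +-cancelʳ-≤ (c * (R * m)) _ _ (begin
    b + length xs * b + c * (R * m)         ≡⟨ identity b (length xs * b) _ ⟩
    b + c * (R * m) + length xs * b         ≤⟨ +-mono-≤ big (∣⋃∣≥ F m b c R xs hs ms (m≤n⇒m≤1+n len)) ⟩
    c * ∣ F x ∣ + c * ∣ U ∣                 ≡⟨ *-distribˡ-+ c ∣ F x ∣ ∣ U ∣ ⟨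
    c * (∣ F x ∣ + ∣ U ∣)                   ≡⟨ cong (c *_) (∣p∪q∣+∣p∩q∣≡∣p∣+∣q∣ (F x) U) ⟨
    c * (∣ F x ∪ U ∣ + ∣ F x ∩ U ∣)         ≡⟨ *-distribˡ-+ c ∣ F x ∪ U ∣ ∣ F x ∩ U ∣ ⟩
    c * ∣ F x ∪ U ∣ + c * ∣ F x ∩ U ∣       ≤⟨ +-monoʳ-≤ (c * ∣ F x ∪ U ∣) (*-monoʳ-≤ c
                                                 (≤-trans (∣p∩⋃∣≤ F (F x) meet) (*-monoˡ-≤ m len))) ⟩
    c * ∣ F x ∪ U ∣ + c * (R * m)           ∎)
    where
    open ≤-Reasoning
    U : Subset n
    U = ⋃ (map F xs)
    identity : ∀ a b c → a + b + c ≡ a + c + b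
    identity = solve-∀

-- Neighbourhoods, cliques and non-adjacency

module _ {n : ℕ} (G : Graph n) where

  NonAdj : Fin n → Fin n → Set
  NonAdj x y = x ≢ y × ¬ Adj G x y

  -- Equal points are exempt, so overlapping sets can be joined and a clique is a set joined to
  -- itself. `Apart` is the negation of `Joined` in positive form.
  Joined Apart : Subset n → Subset n → Set
  Joined p q = ∀ {a b} → a ∈ p → b ∈ q → a ≢ b → Adj G a b
  Apart p q = ∃₂ λ a b → a ∈ p × b ∈ q × NonAdj a b

  Clique : Subset n → Set
  Clique p = Joined p p

  Γ : Fin n → Subset n
  Γ x = tabulate (adj G x)

  Adj-sym : ∀ {x y} → Adj G x y → Adj G y x
  Adj-sym {x} {y} = subst T (sym G x y)

  Adj-irrefl : ∀ {x} → ¬ Adj G x x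
  Adj-irrefl {x} = subst T (irrefl G x)

  NonAdj-sym : ∀ {x y} → NonAdj x y → NonAdj y x
  NonAdj-sym (x≢y , ¬xy) = ≢-sym x≢y , ¬xy ∘ Adj-sym

  ∈Γ⁺ : ∀ {x y} → Adj G x y → y ∈ Γ x
  ∈Γ⁺ {x} = ∈-tabulate⁺ (adj G x)

  ∈Γ⁻ : ∀ {x y} → y ∈ Γ x → Adj G x y
  ∈Γ⁻ {x} = ∈-tabulate⁻ (adj G x)

  ∣Γ∣≡degree : ∀ x → ∣ Γ x ∣ ≡ degree G x
  ∣Γ∣≡degree x = ∣tabulate∣ (adj G x) id

  ∣Γ∩Γ∣≡common : ∀ x y → ∣ Γ x ∩ Γ y ∣ ≡ common G x y
  ∣Γ∩Γ∣≡common x y = trans (cong ∣_∣ (≡.sym (tabulate-∧ (adj G x) (adj G y)))) (∣tabulate∣ (λ w → adj G x w ∧ adj G y w) id)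

  joined-or-apart : ∀ p q → Joined p q ⊎ Apart p q
  joined-or-apart p q with any? (λ a → any? (λ b →
    (a ∈? p) ×-dec (b ∈? q) ×-dec ¬? (a ≟ b) ×-dec ¬? (T? (adj G a b))))
  ... | yes apart = inj₂ apart
  ... | no  none  = inj₁ λ {a} {b} a∈p b∈q a≢b →
    decidable-stable (T? (adj G a b)) λ ¬ab → none (a , b , a∈p , b∈q , a≢b , ¬ab)

  clique-insert : ∀ {x p} → Clique p → (∀ {a} → a ∈ p → x ≢ a → Adj G x a) → Clique (⁅ x ⁆ ∪ p)
  clique-insert {x} {p} clique x~p a∈ b∈ a≢b
    with x∈p∪q⁻ ⁅ x ⁆ p a∈ | x∈p∪q⁻ ⁅ x ⁆ p b∈
  ... | inj₂ a∈p | inj₂ b∈p = clique a∈p b∈p a≢b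
  ... | inj₁ a∈x | inj₂ b∈p rewrite x∈⁅y⁆⇒x≡y x a∈x = x~p b∈p a≢b
  ... | inj₂ a∈p | inj₁ b∈x rewrite x∈⁅y⁆⇒x≡y x b∈x = Adj-sym (x~p a∈p (≢-sym a≢b))
  ... | inj₁ a∈x | inj₁ b∈x = contradiction (trans (x∈⁅y⁆⇒x≡y x a∈x) (≡.sym (x∈⁅y⁆⇒x≡y x b∈x))) a≢b

  -- The closed neighbourhood of x in the subgraph induced on Γ v, for x in Γ v.
  N : Fin n → Fin n → Subset n
  N v x = ⁅ x ⁆ ∪ (Γ v ∩ Γ x)

  x∈N : ∀ v x → x ∈ N v x
  x∈N v x = x∈p∪q⁺ (inj₁ (x∈⁅x⁆ x))

  ∈N⁺ : ∀ {v x z} → Adj G v z → Adj G x z → z ∈ N v x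
  ∈N⁺ vz xz = x∈p∪q⁺ (inj₂ (x∈p∩q⁺ (∈Γ⁺ vz , ∈Γ⁺ xz)))

  ∈N⁻ : ∀ {v x z} → z ∈ N v x → z ≡ x ⊎ (Adj G v z × Adj G x z)
  ∈N⁻ {v} {x} z∈ with x∈p∪q⁻ ⁅ x ⁆ _ z∈
  ... | inj₁ z∈x = inj₁ (x∈⁅y⁆⇒x≡y x z∈x)
  ... | inj₂ z∈∩ with x∈p∩q⁻ (Γ v) (Γ x) z∈∩
  ...   | z∈v , z∈x = inj₂ (∈Γ⁻ z∈v , ∈Γ⁻ z∈x)

  N⊆Γ : ∀ {v x} → Adj G v x → N v x ⊆ Γ v
  N⊆Γ vx z∈ with ∈N⁻ z∈
  ... | inj₁ refl     = ∈Γ⁺ vx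
  ... | inj₂ (vz , _) = ∈Γ⁺ vz

  ∉N : ∀ {v x z} → NonAdj z x → z ∉ N v x
  ∉N (z≢x , ¬zx) z∈ with ∈N⁻ z∈
  ... | inj₁ z≡x      = z≢x z≡x
  ... | inj₂ (_ , xz) = ¬zx (Adj-sym xz)

  ∉N⇒NonAdj : ∀ {v x z} → Adj G v z → z ∉ N v x → NonAdj z x
  ∉N⇒NonAdj {v} {x} vz z∉ = (λ { refl → z∉ (x∈N v x) }) , λ zx → z∉ (∈N⁺ vz (Adj-sym zx))

  Independent : Fin n → List (Fin n) → Set
  Independent v S = All (Adj G v) S × AllPairs NonAdj S

  neighbourhoods : Fin n → List (Fin n) → Subset n
  neighbourhoods v S = ⋃ (map (N v) S)

  ∉neighbourhoods : ∀ {v z S} → All (NonAdj z) S → z ∉ neighbourhoods v S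
  ∉neighbourhoods []                z∈ = ∉⊥ z∈
  ∉neighbourhoods {v} (zx ∷ zS) z∈ = [ ∉N {v} zx , ∉neighbourhoods zS ]′ (x∈p∪q⁻ (N v _) _ z∈)

  ∉neighbourhoods⇒NonAdj : ∀ {v z} S → Adj G v z → z ∉ neighbourhoods v S → All (NonAdj z) S
  ∉neighbourhoods⇒NonAdj []      vz z∉ = []
  ∉neighbourhoods⇒NonAdj (x ∷ S) vz z∉ =
    ∉N⇒NonAdj vz (z∉ ∘ x∈p∪q⁺ ∘ inj₁) ∷ ∉neighbourhoods⇒NonAdj S vz (z∉ ∘ x∈p∪q⁺ ∘ inj₂)

  private-neighbours : Fin n → Fin n → List (Fin n) → Subset n
  private-neighbours v x S = N v x ∩ ∁ (neighbourhoods v S)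

  -- Points of `Γ v` outside every neighbourhood centred in S are non-adjacent to all of S, so a and
  -- b can together take the place of x.
  independent-split : ∀ {v x S a b} → Independent v (x ∷ S) →
    a ∈ private-neighbours v x S → b ∈ private-neighbours v x S → NonAdj a b →
    Independent v (a ∷ b ∷ S)
  independent-split {v} {x} {S} (vx ∷ vS , _ ∷ indep) a∈ b∈ ab =
    let va , aS = split a∈ ; vb , bS = split b∈ in
    va ∷ vb ∷ vS , (ab ∷ aS) ∷ bS ∷ indep
    where
    split : ∀ {z} → z ∈ private-neighbours v x S → Adj G v z × All (NonAdj z) S
    split z∈ with x∈p∩q⁻ (N v x) _ z∈
    ... | z∈N , z∈∁ with ∈Γ⁻ (N⊆Γ vx z∈N)
    ...   | vz = vz , ∉neighbourhoods⇒NonAdj S vz (x∈∁p⇒x∉p z∈∁)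

  independent-swap : ∀ {v x y S} → Independent v (x ∷ y ∷ S) → Independent v (y ∷ x ∷ S)
  independent-swap (vx ∷ vy ∷ vS , (xy ∷ xS) ∷ yS ∷ indep) =
    vy ∷ vx ∷ vS , (NonAdj-sym xy ∷ yS) ∷ xS ∷ indep

-- Neighbourhood sizes in terms of the parameters.

module _ {n k l m : ℕ} (G : Graph n) (H : SubAmplyRegular G k l m) where

  s μ : ℕ
  s = suc l
  μ = m ∸ 1

  ∣Γ∣≡k : ∀ v → ∣ Γ G v ∣ ≡ k
  ∣Γ∣≡k v = trans (∣Γ∣≡degree G v) (proj₁ H v)

  ∣N∣≡s : ∀ {v x} → Adj G v x → ∣ N G v x ∣ ≡ s
  ∣N∣≡s {v} {x} vx = trans
    (∣⁅x⁆∪p∣≡1+∣p∣ _ λ x∈ → Adj-irrefl G (∈Γ⁻ G (proj₂ (x∈p∩q⁻ (Γ G v) (Γ G x) x∈))))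
    (cong suc (trans (∣Γ∩Γ∣≡common G v x) (proj₁ (proj₂ H) v x vx)))

  ∣Γ∩Γ∣≤m : ∀ {x y z} → NonAdj G x y → Adj G x z → Adj G y z → ∣ Γ G x ∩ Γ G y ∣ ≤ m
  ∣Γ∩Γ∣≤m {x} {y} {z} (x≢y , ¬xy) xz yz = ≤-trans (≤-reflexive (∣Γ∩Γ∣≡common G x y))
    (proj₂ (proj₂ H) x y (x≢y , ¬xy , z , xz , Adj-sym G yz))

  -- Besides the points of the intersection, v itself is a common neighbour of x and y; this
  -- accounts for the 1 subtracted from m.
  ∣N∩N∣≤μ : ∀ {v x y} → Adj G v x → Adj G v y → NonAdj G x y → ∣ N G v x ∩ N G v y ∣ ≤ μ
  ∣N∩N∣≤μ {v} {x} {y} vx vy xy = <⇒≤pred (begin-strict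
    ∣ N G v x ∩ N G v y ∣            <⟨ n<1+n _ ⟩
    suc ∣ N G v x ∩ N G v y ∣        ≡⟨ ∣⁅x⁆∪p∣≡1+∣p∣ _ v∉ ⟨
    ∣ ⁅ v ⁆ ∪ (N G v x ∩ N G v y) ∣  ≤⟨ p⊆q⇒∣p∣≤∣q∣ v∪N∩N⊆Γ∩Γ ⟩
    ∣ Γ G x ∩ Γ G y ∣                ≤⟨ ∣Γ∩Γ∣≤m xy (Adj-sym G vx) (Adj-sym G vy) ⟩
    m                                ∎)
    where
    open ≤-Reasoning
    v∉ : v ∉ N G v x ∩ N G v y
    v∉ v∈ = Adj-irrefl G (∈Γ⁻ G (N⊆Γ G vx (proj₁ (x∈p∩q⁻ (N G v x) (N G v y) v∈))))
    v∪N∩N⊆Γ∩Γ : ⁅ v ⁆ ∪ (N G v x ∩ N G v y) ⊆ Γ G x ∩ Γ G y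
    v∪N∩N⊆Γ∩Γ z∈ with x∈p∪q⁻ ⁅ v ⁆ _ z∈
    ... | inj₁ z∈v rewrite x∈⁅y⁆⇒x≡y v z∈v = x∈p∩q⁺ (∈Γ⁺ G (Adj-sym G vx) , ∈Γ⁺ G (Adj-sym G vy))
    ... | inj₂ z∈N∩N with x∈p∩q⁻ (N G v x) (N G v y) z∈N∩N
    ...   | z∈Nx , z∈Ny with ∈N⁻ G z∈Nx | ∈N⁻ G z∈Ny
    ...     | inj₂ (_ , xz) | inj₂ (_ , yz) = x∈p∩q⁺ (∈Γ⁺ G xz , ∈Γ⁺ G yz)
    ...     | inj₁ refl     | _             = contradiction z∈Ny (∉N G xy)
    ...     | inj₂ _        | inj₁ refl     = contradiction z∈Nx (∉N G (NonAdj-sym G xy))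

  -- `N v x` has s points, lies in `Γ v` and misses y. By regularity, a single such triple yields
  -- the inequality for the whole graph.
  s<k-if-nonadjacent : ∀ {v x y} → Adj G v x → Adj G v y → NonAdj G x y → s < k
  s<k-if-nonadjacent {v} {x} {y} vx vy xy = begin-strict
    s                    <⟨ ≤-reflexive (cong suc (≡.sym (∣N∣≡s vx))) ⟩
    suc ∣ N G v x ∣      ≡⟨ ∣⁅x⁆∪p∣≡1+∣p∣ (N G v x) (∉N G (NonAdj-sym G xy)) ⟨
    ∣ ⁅ y ⁆ ∪ N G v x ∣  ≤⟨ p⊆q⇒∣p∣≤∣q∣ y∪N⊆Γ ⟩
    ∣ Γ G v ∣            ≡⟨ ∣Γ∣≡k v ⟩
    k                    ∎
    where
    open ≤-Reasoning
    y∪N⊆Γ : ⁅ y ⁆ ∪ N G v x ⊆ Γ G v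
    y∪N⊆Γ z∈ with x∈p∪q⁻ ⁅ y ⁆ _ z∈
    ... | inj₁ z∈y rewrite x∈⁅y⁆⇒x≡y y z∈y = ∈Γ⁺ G vy
    ... | inj₂ z∈N = N⊆Γ G vx z∈N

  -- Independent sets in a neighbourhood.

  module _ (s<k : s < k) (5kμ≤s² : 5 * (k * μ) ≤ s * s) where
    open ≤-Reasoning

    -- The two bounds support each other in an induction on S. Spread for the tail leaves each
    -- neighbourhood at least 2s/3 new points inside `Γ v`, which has k points; the resulting size
    -- bound gives spread for the longer list.
    independent-size : ∀ {v} S → Independent G v S → length S * (2 * s) ≤ 3 * k
    independent-spread : ∀ {v} S → Independent G v S → 3 * (length S * μ) ≤ s

    independent-spread S indep = packing-bound (length S) s k μ (independent-size S indep) 5kμ≤s²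

    independent-size []      _ = z≤n
    independent-size {v} (x ∷ S) (vx ∷ vS , xS ∷ indep) = begin
      length (x ∷ S) * (2 * s)               ≤⟨ ∣⋃∣≥ (N G v) μ (2 * s) 3 (length S) (x ∷ S)
                                                  (All.map large (vx ∷ vS))
                                                  (pairwise (vx ∷ vS) (xS ∷ indep)) ≤-refl ⟩
      3 * ∣ neighbourhoods G v (x ∷ S) ∣     ≤⟨ *-monoʳ-≤ 3 (p⊆q⇒∣p∣≤∣q∣ (⋃-⊆ (N G v) (All.map {Q = λ z → N G v z ⊆ Γ G v} (λ vz → N⊆Γ G vz) (vx ∷ vS)))) ⟩
      3 * ∣ Γ G v ∣                          ≡⟨ cong (3 *_) (∣Γ∣≡k v) ⟩
      3 * k                                  ∎
      where
      identity : ∀ s → 2 * s + s ≡ 3 * s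
      identity = solve-∀
      large : ∀ {z} → Adj G v z → 2 * s + 3 * (length S * μ) ≤ 3 * ∣ N G v z ∣
      large {z} vz = begin
        2 * s + 3 * (length S * μ)  ≤⟨ +-monoʳ-≤ (2 * s) (independent-spread S (vS , indep)) ⟩
        2 * s + s                   ≡⟨ identity s ⟩
        3 * s                       ≡⟨ cong (3 *_) (∣N∣≡s vz) ⟨
        3 * ∣ N G v z ∣             ∎
      pairwise : ∀ {S} → All (Adj G v) S → AllPairs (NonAdj G) S →
                 AllPairs (λ a b → ∣ N G v a ∩ N G v b ∣ ≤ μ) S
      pairwise []        []          = []
      pairwise (va ∷ vS) (aS ∷ indep) =
        All.zipWith (λ (vb , ab) → ∣N∩N∣≤μ va vb ab) (vS , aS) ∷ pairwise vS indep

    -- Two apart lines through every vertex.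

    Line : Subset n → Set
    Line L = Clique G L × 2 * s + 3 ≤ 3 * ∣ L ∣

    ApartLinesThrough : Fin n → Set
    ApartLinesThrough v = ∃₂ λ L M → v ∈ L × v ∈ M × Line L × Line M × Apart G L M

    -- Of the s points of `N v x`, those centred in S cover at most |S|μ ≤ s/3, so at least 2s/3 are
    -- private; v is the additional point.
    private-line : ∀ {v x S} → Independent G v (x ∷ S) →
                   Clique G (private-neighbours G v x S) → Line (⁅ v ⁆ ∪ private-neighbours G v x S)
    private-line {v} {x} {S} (vx ∷ vS , xS ∷ indep) clique = clique-insert G clique (λ a∈P _ → P⊆Γ a∈P) , (begin
      2 * s + 3             ≤⟨ +-monoˡ-≤ 3 2s≤3P ⟩
      3 * ∣ P ∣ + 3         ≡⟨ identity₁ ∣ P ∣ ⟩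
      3 * suc ∣ P ∣         ≡⟨ cong (3 *_) (∣⁅x⁆∪p∣≡1+∣p∣ P (Adj-irrefl G ∘ P⊆Γ)) ⟨
      3 * ∣ ⁅ v ⁆ ∪ P ∣     ∎)
      where
      P : Subset n
      P = private-neighbours G v x S
      P⊆Γ : ∀ {a} → a ∈ P → Adj G v a
      P⊆Γ a∈P = ∈Γ⁻ G (N⊆Γ G vx (proj₁ (x∈p∩q⁻ (N G v x) _ a∈P)))
      identity₁ : ∀ p → 3 * p + 3 ≡ 3 * suc p
      identity₁ = solve-∀
      identity₂ : ∀ s → s + 2 * s ≡ 3 * s
      identity₂ = solve-∀
      2s≤3P : 2 * s ≤ 3 * ∣ P ∣
      2s≤3P = +-cancelˡ-≤ s _ _ (begin
        s + 2 * s                                                    ≡⟨ identity₂ s ⟩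
        3 * s                                                        ≡⟨ cong (3 *_) (∣N∣≡s vx) ⟨
        3 * ∣ N G v x ∣                                              ≤⟨ *-monoʳ-≤ 3 (∣p∣≤∣p∩q∣+∣p∩∁q∣ (N G v x) (neighbourhoods G v S)) ⟩
        3 * (∣ N G v x ∩ neighbourhoods G v S ∣ + ∣ P ∣)             ≤⟨ *-monoʳ-≤ 3 (+-monoˡ-≤ ∣ P ∣ (∣p∩⋃∣≤ (N G v) (N G v x)
                                                                          (All.zipWith (λ (vy , xy) → ∣N∩N∣≤μ vx vy xy) (vS , xS)))) ⟩
        3 * (length S * μ + ∣ P ∣)                                   ≡⟨ *-distribˡ-+ 3 (length S * μ) ∣ P ∣ ⟩
        3 * (length S * μ) + 3 * ∣ P ∣                               ≤⟨ +-monoˡ-≤ _ (independent-spread S (vS , indep)) ⟩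
        s + 3 * ∣ P ∣                                                ∎)

    x∈private : ∀ {v x S} → All (NonAdj G x) S → x ∈ private-neighbours G v x S
    x∈private {v} {x} xS = x∈p∩q⁺ (x∈N G v x , x∉p⇒x∈∁p (∉neighbourhoods G xS))

    -- Only the two leading vertices are tested. If either private set is not a clique, the
    -- independent set gains a vertex, which `independent-size` allows fewer than 3k + 1 times; the
    -- fuel records what remains of this budget.
    grow : ∀ fuel {v x y} S → Independent G v (x ∷ y ∷ S) → 3 * k < length S + fuel → ApartLinesThrough v
    grow zero {x = x} {y} S indep 3k<∣S∣ = contradiction (begin-strict
      3 * k                            <⟨ 3k<∣S∣ ⟩
      length S + 0                     ≡⟨ +-identityʳ _ ⟩
      length S                         ≤⟨ m≤n+m _ 2 ⟩
      length (x ∷ y ∷ S)               ≤⟨ m≤m*n _ (2 * s) ⟩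
      length (x ∷ y ∷ S) * (2 * s)     ≤⟨ independent-size (x ∷ y ∷ S) indep ⟩
      3 * k                            ∎) (<-irrefl refl)
    grow (suc fuel) {v} {x} {y} S indep@(_ , (xy ∷ xS) ∷ yS ∷ _) 3k<
      with joined-or-apart G (private-neighbours G v x (y ∷ S)) (private-neighbours G v x (y ∷ S))
         | joined-or-apart G (private-neighbours G v y (x ∷ S)) (private-neighbours G v y (x ∷ S))
    ... | inj₂ (a , b , a∈ , b∈ , ab) | _ =
      grow fuel (y ∷ S) (independent-split G indep a∈ b∈ ab) (subst (3 * k <_) (+-suc (length S) fuel) 3k<)
    ... | inj₁ _ | inj₂ (a , b , a∈ , b∈ , ab) =
      grow fuel (x ∷ S) (independent-split G (independent-swap G indep) a∈ b∈ ab) (subst (3 * k <_) (+-suc (length S) fuel) 3k<)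
    ... | inj₁ cliqueˣ | inj₁ cliqueʸ =
      -- Each of x and y is private to itself, so this non-adjacent pair shows the two lines to be
      -- apart.
      _ , _ , x∈p∪q⁺ (inj₁ (x∈⁅x⁆ v)) , x∈p∪q⁺ (inj₁ (x∈⁅x⁆ v))
      , private-line indep cliqueˣ , private-line (independent-swap G indep) cliqueʸ
      , x , y , x∈p∪q⁺ (inj₂ (x∈private (xy ∷ xS))) , x∈p∪q⁺ (inj₂ (x∈private (NonAdj-sym G xy ∷ yS))) , xy

    neighbour : ∀ v → ∃ λ x → Adj G v x
    neighbour v =
      let x , x∈Γ , _ = ∣q∣<∣p∣⇒p⊈q (Γ G v) ⊥ ∣⊥∣<∣Γ∣ in x , ∈Γ⁻ G x∈Γ
      where
      ∣⊥∣<∣Γ∣ : ∣ ⊥ {n} ∣ < ∣ Γ G v ∣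
      ∣⊥∣<∣Γ∣ rewrite ∣⊥∣≡0 n | ∣Γ∣≡k v = ≤-<-trans z≤n s<k

    nonadjacent-neighbour : ∀ {v x} → Adj G v x → ∃ λ y → Adj G v y × NonAdj G x y
    nonadjacent-neighbour {v} {x} vx =
      let y , y∈Γ , y∉N = ∣q∣<∣p∣⇒p⊈q (Γ G v) (N G v x) ∣N∣<∣Γ∣
      in y , ∈Γ⁻ G y∈Γ , NonAdj-sym G (∉N⇒NonAdj G (∈Γ⁻ G y∈Γ) y∉N)
      where
      ∣N∣<∣Γ∣ : ∣ N G v x ∣ < ∣ Γ G v ∣
      ∣N∣<∣Γ∣ rewrite ∣N∣≡s vx | ∣Γ∣≡k v = s<k

    apart-lines : ∀ v → ApartLinesThrough v
    apart-lines v =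
      let x , vx = neighbour v ; y , vy , xy = nonadjacent-neighbour vx
      -- A vertex of `Γ v` outside `N v x` exists because s < k, and it completes the initial
      -- independent pair.
      in grow (suc (3 * k)) [] (vx ∷ vy ∷ [] , (xy ∷ []) ∷ [] ∷ []) ≤-refl

    -- How lines meet.

    -- Apart from x and y, the union consists of common neighbours of x and y, so it has at most s +
    -- 1 points. Non-adjacent a in L and b in M would force |L ∩ M| ≤ m, and adding up sizes gives s
    -- + 3 ≤ 3m, against `3m<s+3`.
    lines-join : ∀ {L M x y} → Line L → Line M → x ∈ L → y ∈ L → x ∈ M → y ∈ M → x ≢ y → Joined G L M
    lines-join {L} {M} {x} {y} (cliqueᴸ , bigᴸ) (cliqueᴹ , bigᴹ) x∈L y∈L x∈M y∈M x≢y
      with joined-or-apart G L M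
    ... | inj₁ joined = joined
    ... | inj₂ (a , b , a∈L , b∈M , ab@(a≢b , ¬ab)) = contradiction 3m≥s+3 (<⇒≱ (3m<s+3 m s k (<⇒≤ s<k) 5kμ≤s²))
      where
      identity : ∀ s → 3 * suc s + (s + 3) ≡ 2 * s + 3 + (2 * s + 3)
      identity = solve-∀
      L∪M⊆ : L ∪ M ⊆ ⁅ x ⁆ ∪ N G x y
      L∪M⊆ {z} z∈ with x ≟ z | y ≟ z
      ... | yes refl | _        = x∈p∪q⁺ (inj₁ (x∈⁅x⁆ x))
      ... | no _     | yes refl = x∈p∪q⁺ (inj₂ (x∈N G x y))
      ... | no x≢z   | no y≢z with x∈p∪q⁻ L M z∈
      ...   | inj₁ z∈L = x∈p∪q⁺ (inj₂ (∈N⁺ G (cliqueᴸ x∈L z∈L x≢z) (cliqueᴸ y∈L z∈L y≢z)))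
      ...   | inj₂ z∈M = x∈p∪q⁺ (inj₂ (∈N⁺ G (cliqueᴹ x∈M z∈M x≢z) (cliqueᴹ y∈M z∈M y≢z)))
      ∣L∪M∣≤1+s : ∣ L ∪ M ∣ ≤ suc s
      ∣L∪M∣≤1+s = begin
        ∣ L ∪ M ∣            ≤⟨ p⊆q⇒∣p∣≤∣q∣ L∪M⊆ ⟩
        ∣ ⁅ x ⁆ ∪ N G x y ∣  ≤⟨ ∣p∪q∣≤∣p∣+∣q∣ ⁅ x ⁆ (N G x y) ⟩
        ∣ ⁅ x ⁆ ∣ + ∣ N G x y ∣  ≡⟨ cong₂ _+_ (∣⁅x⁆∣≡1 x) (∣N∣≡s (cliqueᴸ x∈L y∈L x≢y)) ⟩
        suc s                ∎
      a,b~L∩M : ∀ {z} → z ∈ L ∩ M → Adj G a z × Adj G b z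
      a,b~L∩M z∈ with x∈p∩q⁻ L M z∈
      -- If z were a, then a would lie in M and be adjacent to b; the case z = b is symmetric.
      ... | z∈L , z∈M = cliqueᴸ a∈L z∈L (λ { refl → ¬ab (cliqueᴹ z∈M b∈M a≢b) })
                      , cliqueᴹ b∈M z∈M (λ { refl → ¬ab (cliqueᴸ a∈L z∈L a≢b) })
      L∩M⊆ : L ∩ M ⊆ Γ G a ∩ Γ G b
      L∩M⊆ z∈ with a,b~L∩M z∈
      ... | az , bz = x∈p∩q⁺ (∈Γ⁺ G az , ∈Γ⁺ G bz)
      ∣L∩M∣≤m : ∣ L ∩ M ∣ ≤ m
      ∣L∩M∣≤m with a,b~L∩M (x∈p∩q⁺ (x∈L , x∈M))
      ... | ax , bx = ≤-trans (p⊆q⇒∣p∣≤∣q∣ L∩M⊆) (∣Γ∩Γ∣≤m ab ax bx)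
      3m≥s+3 : s + 3 ≤ 3 * m
      3m≥s+3 = +-cancelˡ-≤ (3 * suc s) _ _ (begin
        3 * suc s + (s + 3)              ≡⟨ identity s ⟩
        2 * s + 3 + (2 * s + 3)          ≤⟨ +-mono-≤ bigᴸ bigᴹ ⟩
        3 * ∣ L ∣ + 3 * ∣ M ∣            ≡⟨ *-distribˡ-+ 3 ∣ L ∣ ∣ M ∣ ⟨
        3 * (∣ L ∣ + ∣ M ∣)              ≡⟨ cong (3 *_) (∣p∪q∣+∣p∩q∣≡∣p∣+∣q∣ L M) ⟨
        3 * (∣ L ∪ M ∣ + ∣ L ∩ M ∣)      ≤⟨ *-monoʳ-≤ 3 (+-mono-≤ ∣L∪M∣≤1+s ∣L∩M∣≤m) ⟩
        3 * (suc s + m)                  ≡⟨ *-distribˡ-+ 3 (suc s) m ⟩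
        3 * suc s + 3 * m                ∎)

    -- Otherwise every point of C is a common neighbour of the non-adjacent a and b, so |C| ≤ m, too
    -- few for a line.
    joined-to-both : ∀ {C L M} → Line C → Apart G L M → Joined G L C → ¬ Joined G M C
    joined-to-both {C} (_ , bigᶜ) (a , b , a∈L , b∈M , ab@(a≢b , ¬ab)) joinedᴸ joinedᴹ = <⇒≱ (3m<s+3 m s k (<⇒≤ s<k) 5kμ≤s²) (begin
        s + 3        ≤⟨ +-monoˡ-≤ 3 (m≤m+n s _) ⟩
        2 * s + 3    ≤⟨ bigᶜ ⟩
        3 * ∣ C ∣    ≤⟨ *-monoʳ-≤ 3 ∣C∣≤m ⟩
        3 * m        ∎)
      where
      a~C : ∀ {z} → z ∈ C → Adj G a z
      a~C z∈C = joinedᴸ a∈L z∈C (λ { refl → ¬ab (Adj-sym G (joinedᴹ b∈M z∈C (≢-sym a≢b))) })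
      b~C : ∀ {z} → z ∈ C → Adj G b z
      b~C z∈C = joinedᴹ b∈M z∈C (λ { refl → ¬ab (joinedᴸ a∈L z∈C a≢b) })
      ∣C∣≤m : ∣ C ∣ ≤ m
      -- The bound m holds for pairs at distance two, so a point of C must serve as the middle
      -- vertex.
      ∣C∣≤m with nonempty? C
      ... | yes (z , z∈C) = ≤-trans
        (p⊆q⇒∣p∣≤∣q∣ λ c∈C → x∈p∩q⁺ (∈Γ⁺ G (a~C c∈C) , ∈Γ⁺ G (b~C c∈C)))
        (∣Γ∩Γ∣≤m ab (a~C z∈C) (b~C z∈C))
      ... | no  empty rewrite Empty-unique empty | ∣⊥∣≡0 n = z≤n

    line-apart-from : ∀ {C} → Line C → ∀ {x} → ApartLinesThrough x → ∃ λ L → x ∈ L × Line L × Apart G L C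
    line-apart-from {C} lineᶜ (L , M , x∈L , x∈M , lineᴸ , lineᴹ , apart)
      with joined-or-apart G L C | joined-or-apart G M C
    ... | inj₂ apartᴸ  | _            = L , x∈L , lineᴸ , apartᴸ
    ... | inj₁ _       | inj₂ apartᴹ  = M , x∈M , lineᴹ , apartᴹ
    ... | inj₁ joinedᴸ | inj₁ joinedᴹ = ⊥-elim (joined-to-both lineᶜ apart joinedᴸ joinedᴹ)

    -- Two common points would join L to M, so y could be added to L. The enlarged line shares the
    -- edge xy with C, and `lines-join` then contradicts that L and C are apart.
    apart-lines-meet-once : ∀ {C L M x y} → Line C → Line L → Line M → Apart G L C →
      x ∈ C → y ∈ C → x ≢ y → x ∈ L → y ∈ M → ∣ L ∩ M ∣ ≤ 1
    apart-lines-meet-once {C} {L} {M} {x} {y} lineᶜ lineᴸ@(cliqueᴸ , bigᴸ) lineᴹ (a , c , a∈L , c∈C , a≢c , ¬ac)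
      x∈C y∈C x≢y x∈L y∈M = ≮⇒≥ λ 1<∣L∩M∣ →
      let p , q , p∈L∩M , q∈L∩M , p≢q = ∣p∣>1⇒two-elements (L ∩ M) 1<∣L∩M∣
          p∈L , p∈M = x∈p∩q⁻ L M p∈L∩M
          q∈L , q∈M = x∈p∩q⁻ L M q∈L∩M
          joined : Joined G L M
          joined = lines-join lineᴸ lineᴹ p∈L q∈L p∈M q∈M p≢q
          lineᴸ′ : Line (⁅ y ⁆ ∪ L)
          lineᴸ′ = clique-insert G cliqueᴸ (λ z∈L y≢z → Adj-sym G (joined z∈L y∈M (≢-sym y≢z)))
                 , ≤-trans bigᴸ (*-monoʳ-≤ 3 (∣q∣≤∣p∪q∣ ⁅ y ⁆ L))
      in ¬ac (lines-join lineᴸ′ lineᶜ (x∈p∪q⁺ (inj₂ x∈L)) (x∈p∪q⁺ (inj₁ (x∈⁅x⁆ y))) x∈C y∈C x≢y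
                (x∈p∪q⁺ (inj₂ a∈L)) c∈C a≢c)

    -- Counting the points on many lines.

    3[s/3]≤s : 3 * (s / 3) ≤ s
    3[s/3]≤s = ≤-trans (≤-reflexive (*-comm 3 (s / 3))) (m/n*n≤m s 3)

    s/3<∣line∣ : ∀ {C} → Line C → s / 3 < ∣ C ∣
    s/3<∣line∣ {C} (_ , bigᶜ) = *-cancelˡ-≤ 3 (begin
      3 * suc (s / 3)   ≡⟨ *-suc 3 (s / 3) ⟩
      3 + 3 * (s / 3)   ≤⟨ +-monoʳ-≤ 3 3[s/3]≤s ⟩
      3 + s             ≤⟨ +-monoʳ-≤ 3 (m≤m+n s _) ⟩
      3 + 2 * s         ≡⟨ +-comm 3 (2 * s) ⟩
      2 * s + 3         ≤⟨ bigᶜ ⟩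
      3 * ∣ C ∣         ∎)

    -- Each line has at least 2s/3 + 1 points and loses at most `s / 3` of them to the later lines,
    -- one to each, so it adds at least s/3 + 1 points to the union.
    union-of-lines : ∀ {C} → Line C → (L : Fin n → Subset n) → (∀ x → x ∈ L x × Line (L x) × Apart G (L x) C) →
                     ∀ xs → length xs ≡ suc (s / 3) → All (_∈ C) xs → Unique xs → length xs * (s + 3) ≤ 3 * n
    union-of-lines {C} lineᶜ L lineᴸ xs ∣xs∣≡ xs∈C unique = begin
      length xs * (s + 3)     ≤⟨ ∣⋃∣≥ L 1 (s + 3) 3 (s / 3) xs (All.universal large xs)
                                   (pairwise xs∈C unique) (≤-reflexive ∣xs∣≡) ⟩
      3 * ∣ ⋃ (map L xs) ∣    ≤⟨ *-monoʳ-≤ 3 (∣p∣≤n (⋃ (map L xs))) ⟩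
      3 * n                   ∎
      where
      identity : ∀ s → s + 3 + s ≡ 2 * s + 3
      identity = solve-∀
      large : ∀ x → s + 3 + 3 * (s / 3 * 1) ≤ 3 * ∣ L x ∣
      large x = begin
        s + 3 + 3 * (s / 3 * 1)  ≡⟨ cong (λ r → s + 3 + 3 * r) (*-identityʳ (s / 3)) ⟩
        s + 3 + 3 * (s / 3)      ≤⟨ +-monoʳ-≤ (s + 3) 3[s/3]≤s ⟩
        s + 3 + s                ≡⟨ identity s ⟩
        2 * s + 3                ≤⟨ proj₂ (proj₁ (proj₂ (lineᴸ x))) ⟩
        3 * ∣ L x ∣              ∎
      meet : ∀ {x y} → x ∈ C → y ∈ C → x ≢ y → ∣ L x ∩ L y ∣ ≤ 1
      meet {x} {y} x∈C y∈C x≢y =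
        let x∈Lx , lineˣ , apart = lineᴸ x
            y∈Ly , lineʸ , _     = lineᴸ y
        in apart-lines-meet-once lineᶜ lineˣ lineʸ apart x∈C y∈C x≢y x∈Lx y∈Ly
      pairwise : ∀ {xs} → All (_∈ C) xs → Unique xs → AllPairs (λ x y → ∣ L x ∩ L y ∣ ≤ 1) xs
      pairwise []           []              = []
      pairwise (x∈C ∷ xs∈C) (x≢xs ∷ unique) =
        All.zipWith (λ (y∈C , x≢y) → meet x∈C y∈C x≢y) (xs∈C , x≢xs) ∷ pairwise xs∈C unique

    line⇒s²<9n : ∀ {C} → Line C → s * s < 9 * n
    line⇒s²<9n {C} lineᶜ =
      -- The number r = `suc (s / 3)` satisfies s < 3r, so s² < 3r(s + 3), which the count bounds by
      -- 9n.
      let xs , ∣xs∣≡ , xs∈C , unique = distinct-elements C (suc (s / 3)) (s/3<∣line∣ lineᶜ)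
          lines x = line-apart-from lineᶜ (apart-lines x)
      in begin-strict
      s * s                        <⟨ *-mono-< (s<3r (≡.sym ∣xs∣≡)) (m<m+n s z<s) ⟩
      3 * length xs * (s + 3)      ≡⟨ *-assoc 3 (length xs) (s + 3) ⟩
      3 * (length xs * (s + 3))    ≤⟨ *-monoʳ-≤ 3 (union-of-lines lineᶜ (proj₁ ∘ lines) (proj₂ ∘ lines) xs ∣xs∣≡ xs∈C unique) ⟩
      3 * (3 * n)                  ≡⟨ *-assoc 3 3 n ⟨
      9 * n                        ∎
      where
      s<3r : ∀ {r} → suc (s / 3) ≡ r → s < 3 * r
      s<3r refl = begin-strict
        s                          ≡⟨ m≡m%n+[m/n]*n s 3 ⟩
        s % 3 + s / 3 * 3          <⟨ +-monoˡ-< (s / 3 * 3) (m%n<n s 3) ⟩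
        3 + s / 3 * 3              ≡⟨ *-comm (suc (s / 3)) 3 ⟩
        3 * suc (s / 3)            ∎

    s²<9n : Fin n → s * s < 9 * n
    s²<9n v = let _ , _ , _ , _ , line , _ = apart-lines v in line⇒s²<9n line

theorem1 : (n k l m : ℕ) (G : Graph n) → SubAmplyRegular G k l m → ¬ DisjointUnionOfCliques G →
    ((l + 1) <√ (32 * n)) ⊎ LtC (l + 1) (k * (m ∸ 1))
theorem1 n k l m G H ¬cliques with (l + 1) * (l + 1) <? 32 * n | LtC-or-≥ (l + 1) (k * (m ∸ 1))
... | yes small | _          = inj₁ small
... | no  _     | inj₁ small = inj₂ small
-- The rewrite turns `l + 1` into `suc l`, the form of `s`.
... | no  large | inj₂ 5kμ≤s² rewrite +-comm l 1 = contradiction cliques ¬cliques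
  where
  cliques : DisjointUnionOfCliques G
  -- A path u, v, w without the edge uw would give s < k and hence s² < 9n ≤ 32n, against `large`.
  cliques u v w uv vw u≢w = decidable-stable (T? (adj G u w)) λ ¬uw →
    large (<-≤-trans
      (s²<9n G H (s<k-if-nonadjacent G H (Adj-sym G uv) vw (u≢w , ¬uw)) 5kμ≤s² v)
      (*-monoˡ-≤ n (m≤m+n 9 23)))
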